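{- For every $n\ge1$, the number of matchings on $[2n]$ that avoid the pattern $12312$ equals the $3$-Catalan number $C_{n,3}=\frac{1}{2n+1}\binom{3n}{n}$.
   Context: A matching on $[2n]$ is a partition of $[2n]$ into $n$ blocks of size two (edges). The canonical sequential form of a matching with $n$ edges is the word of length $2n$ obtained by labeling edges $1,\dots,n$ in increasing order of their smaller elements and writing at each position the label of the edge containing it. Words $a_1\cdots a_k$, $b_1\cdots b_k$ are order-isomorphic if $a_i<a_j\iff b_i<b_j$ for all $i,j$. A matching contains a pattern $\tau$ if its canonical sequential form has a subsequence order-isomorphic to $\tau$, and avoids $\tau$ otherwise. The $k$-Catalan numbers are $C_{n,k}=\frac{1}{(k-1)n+1}\binom{kn}{n}$. -}

module Defs where

open import Data.Nat using (ℕ; suc; _*_; _<_)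
open import Data.Nat.Combinatorics using (_C_)
open import Data.Nat.DivMod using (_/_)
open import Data.Fin using (Fin) renaming (_<_ to _<ᶠ_; _≤_ to _≤ᶠ_)
open import Data.Fin.Properties using (_<?_; _≤?_)
open import Data.Vec using (Vec; lookup; _∷_; [])
open import Data.List using (List; length; filter)
open import Data.Fin using (toℕ)
open import Data.List using () renaming (tabulate to ltabulate)
open import Data.Product using (_×_; Σ; ∃)
open import Function.Bundles using (_⇔_)
open import Relation.Binary.PropositionalEquality using (_≡_; _≢_)
open import Relation.Nullary using (¬_)
open import Relation.Nullary.Decidable using (_×-dec_)

-- A matching on [2n] (positions Fin (2 * n)) is represented by its
-- partner function, stored as a vector: a fixed-point-free involution.
-- Each edge {i, v[i]} is a block of size two.
IsMatching : (n : ℕ) → Vec (Fin (2 * n)) (2 * n) → Set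
IsMatching n v = ∀ i → (lookup v (lookup v i) ≡ i) × (lookup v i ≢ i)

minF : ∀ {m} → Fin m → Fin m → Fin m
minF i j with i ≤? j
... | Relation.Nullary.yes _ = i
... | Relation.Nullary.no _ = j

-- Canonical sequential form: the label of the edge containing position i
-- is the number of edges whose smaller element is ≤ the smaller element
-- of i's edge (edges labelled 1..n in increasing order of smaller elements).
canon : (n : ℕ) → Vec (Fin (2 * n)) (2 * n) → Fin (2 * n) → ℕ
canon n v i =
  length (filter (λ j → (j <? lookup v j) ×-dec (j ≤? minF i (lookup v i)))
                 (ltabulate {n = 2 * n} (λ j → j)))

Contains : ∀ {m k} → (Fin m → ℕ) → Vec ℕ k → Set
Contains {m} {k} w τ =
  Σ (Fin k → Fin m) λ f →
    (∀ i j → i <ᶠ j → f i <ᶠ f j) ×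
    (∀ i j → (lookup τ i < lookup τ j) ⇔ (w (f i) < w (f j)))

Avoids : (n : ℕ) → Vec (Fin (2 * n)) (2 * n) → ∀ {k} → Vec ℕ k → Set
Avoids n v τ = ¬ Contains (canon n v) τ

pattern12312 : Vec ℕ 5
pattern12312 = 1 ∷ 2 ∷ 3 ∷ 1 ∷ 2 ∷ []

-- k-Catalan number C_{n,k} = binom(kn, n) / ((k-1)n + 1)  (exact division)
kCatalan : ℕ → ℕ → ℕ
kCatalan n k = ((k * n) C n) / suc ((k Data.Nat.∸ 1) * n)

{-# OPTIONS --safe #-}
module Submission where

-- Read a matching π from left to right, keeping the stack of its open edges.
-- An occurrence of 12312 amounts to a crossing a < b < π a < π b with an opener
-- strictly between b and π a.  Hence π avoids it iff each closer closes either the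
-- top of the stack, or the second edge from the top while the top is still the last
-- opener that was read.  The number of such histories satisfies the recurrence of the
-- lattice paths from (0,0) to (2n,n) below the line x = 2y.

open import Defs
open import Data.Fin using (Fin; toℕ; fromℕ<; zero; suc)
open import Data.Fin.Patterns using (0F; 1F; 2F; 3F; 4F)
import Data.Fin as Fin
import Data.Fin.Properties as Fin
open import Data.List as List using (List; []; _∷_; _++_; map; length; filter)
open import Data.List.Membership.Propositional using (_∈_)
open import Data.List.Membership.Propositional.Properties
  using (∈-++⁺ˡ; ∈-++⁺ʳ; ∈-++⁻; ∈-map⁺; ∈-map⁻; ∈-tabulate⁺)
open import Data.List.Properties using (length-++; length-map)
open import Data.List.Relation.Binary.Disjoint.Propositional using (Disjoint)
open import Data.List.Relation.Unary.All using ([]; _∷_)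
open import Data.List.Relation.Unary.AllPairs using ([]; _∷_)
open import Data.List.Relation.Unary.Any using (here; there)
open import Data.List.Relation.Unary.Unique.Propositional using (Unique)
import Data.List.Relation.Unary.Unique.Propositional.Properties as Unique
open import Data.Nat
open import Data.Nat.Combinatorics using (_C_; nCk+nC[k+1]≡[n+1]C[k+1]; nC1≡n)
open import Data.Nat.DivMod using (m*n/n≡m)
open import Data.Nat.Properties
open import Data.Nat.Tactic.RingSolver using (solve-∀)
open import Data.Product using (Σ; _×_; _,_; ∃; proj₁; proj₂)
open import Data.Sum as Sum using (_⊎_; inj₁; inj₂; [_,_]′)
open import Data.Vec using (Vec; []; _∷_; head; tail; lookup; tabulate)
open import Data.Vec.Membership.Propositional using () renaming (_∈_ to _∈ᵛ_)
open import Data.Vec.Properties using (lookup∘tabulate; tabulate∘lookup; tabulate-cong)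
open import Data.Vec.Relation.Unary.All as All using (All; []; _∷_)
open import Data.Vec.Relation.Unary.AllPairs using (AllPairs; []; _∷_)
open import Data.Vec.Relation.Unary.Any using (here; there)
open import Data.Vec.Relation.Unary.Linked using ([-]; _∷_)
open import Data.Vec.Relation.Unary.Linked.Properties using (lookup⁺)
open import Function using (_∘_; id)
open import Function.Bundles using (_⇔_; mk⇔; Equivalence)
open import Level using (0ℓ)
open import Relation.Binary.Definitions using (tri<; tri≈; tri>)
open import Relation.Binary.PropositionalEquality
open import Relation.Nullary using (¬_; yes; no)
open import Relation.Nullary.Decidable using (_×-dec_)
open import Relation.Nullary.Negation using (contradiction)
open import Relation.Unary using (Pred; Decidable; _⊆_)

-- When a closer ends an edge that is not on top of the stack, every edge above it stays open and so
-- crosses it. Such a crossing is forbidden exactly when some opener was read after that of the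
-- crossing edge. From depth three on this always happens: the second edge crosses, and the top one
-- was opened after it. At depth two only the top crosses, and an opener read after it must have
-- been closed already, since it is not on the stack. So one bit besides the height, `fresh` or
-- `stale`, is all the memory that a reader of the matching needs. It also explains the slope of the
-- line: each edge costs two units east, one when it is opened and one when it ceases to be fresh,
-- against one unit north when it is closed.
--
-- A matching cut short is not a matching, and vectors over `Fin` would change type with the cut.
-- Hence the bijection is built on involutions of all natural numbers, where open and unread
-- positions are fixed points.

-- Ballot numbers for the line x = 2y and their closed form

-- The number of lattice paths from (0,0) to (2y + d, y), with unit steps east and
-- north, that stay in the region 2 * ordinate ≤ abscissa.
ballot : ℕ → ℕ → ℕ
ballot zero    d       = 1
ballot (suc y) zero    = ballot y 2
ballot (suc y) (suc d) = ballot (suc y) d + ballot y (3 + d)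

absorption : ∀ n k → suc k * (suc n C suc k) ≡ suc n * (n C k)
absorption zero zero = refl
absorption zero (suc k) = *-zeroʳ (suc (suc k))
absorption (suc n) zero = trans (+-identityʳ _) (trans (nC1≡n (2 + n)) (sym (*-identityʳ _)))
absorption (suc n) (suc k) = begin
  (2 + k) * ((2 + n) C (2 + k)) ≡⟨ cong ((2 + k) *_) (nCk+nC[k+1]≡[n+1]C[k+1] (suc n) (suc k)) ⟨
  (2 + k) * (u + v) ≡⟨ split k u v ⟩
  u + (suc k * u + (2 + k) * v)
      ≡⟨ cong₂ (λ p q → u + (p + q)) (absorption n k) (absorption n (suc k)) ⟩
  u + (suc n * (n C k) + suc n * (n C suc k))
      ≡⟨ cong (u +_) (*-distribˡ-+ (suc n) (n C k) (n C suc k)) ⟨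
  u + suc n * (n C k + n C suc k) ≡⟨ cong (λ p → u + suc n * p) (nCk+nC[k+1]≡[n+1]C[k+1] n k) ⟩
  (2 + n) * u ∎
  where
  open ≡-Reasoning
  u = suc n C suc k
  v = suc n C (2 + k)
  split : ∀ k u v → (2 + k) * (u + v) ≡ u + (suc k * u + (2 + k) * v)
  split = solve-∀

-- Pascal's rule and `absorption` both evaluate `suc k * (suc (k + r) C suc k)`, and a common
-- summand cancels. Writing the upper index as `k + r` avoids the subtraction n - k.
C-suc : ∀ k r → suc k * ((k + r) C suc k) ≡ r * ((k + r) C k)
C-suc k r = +-cancelˡ-≡ (suc k * ((k + r) C k)) _ _ (begin
  suc k * u + suc k * v ≡⟨ *-distribˡ-+ (suc k) u v ⟨
  suc k * (u + v) ≡⟨ cong (suc k *_) (nCk+nC[k+1]≡[n+1]C[k+1] (k + r) k) ⟩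
  suc k * (suc (k + r) C suc k) ≡⟨ absorption (k + r) k ⟩
  suc (k + r) * u ≡⟨ *-distribʳ-+ u (suc k) r ⟩
  suc k * u + r * u ∎)
  where
  open ≡-Reasoning
  u = (k + r) C k
  v = (k + r) C suc k

-- Truncated subtraction would give 1 at `k = 0`; the value 0 keeps Pascal's rule valid there.
_C⁻_ : ℕ → ℕ → ℕ
n C⁻ zero  = 0
n C⁻ suc k = n C k

pascal⁻ : ∀ n k → n C⁻ k + n C k ≡ suc n C k
pascal⁻ n zero    = refl
pascal⁻ n (suc k) = nCk+nC[k+1]≡[n+1]C[k+1] n k

-- Away from the boundary, `ballot` and both binomials obey Pascal's rule. The factor 2 comes from
-- the boundary: the formula has to vanish one unit beyond it, at d = -1, where ordinate `suc y`
-- gives the upper index `3 * y + 2`; this is `double`.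
ballot-closed : ∀ y d → ballot y d + 2 * ((3 * y + d) C⁻ y) ≡ (3 * y + d) C y
ballot-closed zero    d    = refl
ballot-closed (suc y) zero = begin
  ballot y 2 + 2 * ((3 * suc y + 0) C y)  ≡⟨ cong (λ m → ballot y 2 + 2 * (m C y)) (shift y) ⟩
  ballot y 2 + 2 * (suc n C y)            ≡⟨ cong (λ m → ballot y 2 + 2 * m) (pascal⁻ n y) ⟨
  ballot y 2 + 2 * (n C⁻ y + n C y)       ≡⟨ regroup (ballot y 2) (n C⁻ y) (n C y) ⟩
  ballot y 2 + 2 * (n C⁻ y) + 2 * (n C y) ≡⟨ cong (_+ 2 * (n C y)) (ballot-closed y 2) ⟩
  n C y + 2 * (n C y)                     ≡⟨ cong (n C y +_) double ⟨
  n C y + n C suc y                       ≡⟨ nCk+nC[k+1]≡[n+1]C[k+1] n y ⟩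
  suc n C suc y                           ≡⟨ cong (_C suc y) (shift y) ⟨
  (3 * suc y + 0) C suc y                 ∎
  where
  open ≡-Reasoning
  n = 3 * y + 2
  shift : ∀ y → 3 * suc y + 0 ≡ suc (3 * y + 2)
  shift = solve-∀
  regroup : ∀ a b c → a + 2 * (b + c) ≡ a + 2 * b + 2 * c
  regroup = solve-∀
  halves : ∀ y → 3 * y + 2 ≡ y + 2 * suc y
  halves = solve-∀
  swap : ∀ y c → 2 * suc y * c ≡ suc y * (2 * c)
  swap = solve-∀
  double : n C suc y ≡ 2 * (n C y)
  double = *-cancelˡ-≡ _ _ (suc y) (begin
    suc y * (n C suc y)               ≡⟨ cong (λ m → suc y * (m C suc y)) (halves y) ⟩
    suc y * ((y + 2 * suc y) C suc y) ≡⟨ C-suc y (2 * suc y) ⟩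
    2 * suc y * ((y + 2 * suc y) C y) ≡⟨ cong (λ m → 2 * suc y * (m C y)) (halves y) ⟨
    2 * suc y * (n C y)               ≡⟨ swap y (n C y) ⟩
    suc y * (2 * (n C y))             ∎)
ballot-closed (suc y) (suc d) = begin
  b + b⁺ + 2 * ((3 * suc y + suc d) C y)
      ≡⟨ cong (λ m → b + b⁺ + 2 * (m C y)) (+-suc (3 * suc y) d) ⟩
  b + b⁺ + 2 * (suc n C y)               ≡⟨ cong (λ m → b + b⁺ + 2 * m) (pascal⁻ n y) ⟨
  b + b⁺ + 2 * (n C⁻ y + n C y)          ≡⟨ regroup b b⁺ (n C⁻ y) (n C y) ⟩
  b⁺ + 2 * (n C⁻ y) + (b + 2 * (n C y))  ≡⟨ cong₂ _+_ ih (ballot-closed (suc y) d) ⟩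
  n C y + n C suc y                      ≡⟨ nCk+nC[k+1]≡[n+1]C[k+1] n y ⟩
  suc n C suc y                          ≡⟨ cong (_C suc y) (+-suc (3 * suc y) d) ⟨
  (3 * suc y + suc d) C suc y            ∎
  where
  open ≡-Reasoning
  n  = 3 * suc y + d
  b  = ballot (suc y) d
  b⁺ = ballot y (3 + d)
  regroup : ∀ a b c d → a + b + 2 * (c + d) ≡ b + 2 * c + (a + 2 * d)
  regroup = solve-∀
  shift : ∀ y d → 3 * y + (3 + d) ≡ 3 * suc y + d
  shift = solve-∀
  ih : b⁺ + 2 * (n C⁻ y) ≡ n C y
  ih = subst (λ m → b⁺ + 2 * (m C⁻ y) ≡ m C y) (shift y d) (ballot-closed y (3 + d))

-- Multiplied by `suc (2 * n)`, the subtracted term of the closed form becomes `2 * (n * c)` by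
-- `C-suc` with `r = suc (2 * n)`, so just one `c` remains.
ballot-n0 : ∀ n → ballot n 0 * suc (2 * n) ≡ (3 * n) C n
ballot-n0 zero = refl
ballot-n0 n@(suc k) = +-cancelʳ-≡ (2 * (n * c)) _ _ (begin
  b * suc (2 * n) + 2 * (n * c)       ≡⟨ cong (λ m → b * suc (2 * n) + 2 * m) reflect ⟩
  b * suc (2 * n) + 2 * (suc (2 * n) * c⁻) ≡⟨ regroup b n c⁻ ⟩
  suc (2 * n) * (b + 2 * c⁻) ≡⟨ cong (suc (2 * n) *_) closed ⟩
  suc (2 * n) * c ≡⟨ expand n c ⟩
  c + 2 * (n * c) ∎)
  where
  open ≡-Reasoning
  b  = ballot n 0
  c  = (3 * n) C n
  c⁻ = (3 * n) C k
  regroup : ∀ b n c → b * suc (2 * n) + 2 * (suc (2 * n) * c) ≡ suc (2 * n) * (b + 2 * c)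
  regroup = solve-∀
  expand : ∀ n c → suc (2 * n) * c ≡ c + 2 * (n * c)
  expand = solve-∀
  split : ∀ k → 3 * suc k ≡ k + suc (2 * suc k)
  split = solve-∀
  reflect : n * c ≡ suc (2 * n) * c⁻
  reflect = subst (λ m →
      n * (m C n) ≡ suc (2 * n) * (m C k)) (sym (split k)) (C-suc k (suc (2 * n)))
  closed : b + 2 * c⁻ ≡ c
  closed = subst (λ m → b + 2 * (m C k) ≡ m C n) (+-identityʳ (3 * n)) (ballot-closed n 0)

ballot≡kCatalan : ∀ n → ballot n 0 ≡ kCatalan n 3
ballot≡kCatalan n = begin
  ballot n 0                             ≡⟨ m*n/n≡m (ballot n 0) (suc (2 * n)) ⟨
  ballot n 0 * suc (2 * n) / suc (2 * n) ≡⟨ cong (_/ suc (2 * n)) (ballot-n0 n) ⟩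
  kCatalan n 3                           ∎
  where open ≡-Reasoning

-- Histories: a list without repetitions, and its length

data Kind : Set where
  stale fresh : Kind

-- Walk k y h is a history in which y edges are closed and h are open; in a fresh
-- history there is one more open edge, the top one, which is the last opener read.
data Walk : Kind → ℕ → ℕ → Set where
  start     : Walk stale 0 0
  topFresh  : ∀ {y h} → Walk fresh y h → Walk stale (suc y) h
  topStale  : ∀ {y h} → Walk stale y (suc h) → Walk stale (suc y) h
  openStale : ∀ {y h} → Walk stale y h → Walk fresh y h
  openFresh : ∀ {y h} → Walk fresh y h → Walk fresh y (suc h)
  second    : ∀ {y h} → Walk fresh y (suc h) → Walk fresh (suc y) h

-- Histories are sorted by their last move. The recursion raises `h` only where it lowers `y`.
-- `afterOpen` and `afterSecond` are split off so that each matches only on the index that its move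
-- constrains.
walksStale walksFresh afterOpen afterSecond : ∀ y h → List (Walk _ y h)
walksStale zero    zero    = start ∷ []
walksStale zero    (suc h) = []
walksStale (suc y) h       = map topFresh (walksFresh y h) ++ map topStale (walksStale y (suc h))
walksFresh y h = map openStale (walksStale y h) ++ (afterOpen y h ++ afterSecond y h)
afterOpen y zero    = []
afterOpen y (suc h) = map openFresh (walksFresh y h)
afterSecond zero    h = []
afterSecond (suc y) h = map second (walksFresh y (suc h))

walks : ∀ k y h → List (Walk k y h)
walks stale = walksStale
walks fresh = walksFresh

∈-walks : ∀ {k y h} (w : Walk k y h) → w ∈ walks k y h
∈-walks start         = here refl
∈-walks (topFresh w)  = ∈-++⁺ˡ (∈-map⁺ topFresh (∈-walks w))
∈-walks (topStale w)  = ∈-++⁺ʳ _ (∈-map⁺ topStale (∈-walks w))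
∈-walks (openStale w) = ∈-++⁺ˡ (∈-map⁺ openStale (∈-walks w))
∈-walks {y = y} {h} (openFresh w) =
  ∈-++⁺ʳ (map openStale (walksStale y h)) (∈-++⁺ˡ (∈-map⁺ openFresh (∈-walks w)))
∈-walks {y = y} {h} (second w) =
  ∈-++⁺ʳ (map openStale (walksStale y h)) (∈-++⁺ʳ (afterOpen y h) (∈-map⁺ second (∈-walks w)))

map-disjoint : ∀ {A B C : Set} {f : A → C} {g : B → C} (xs : List A) (ys : List B) →
               (∀ {x y} → f x ≢ g y) → Disjoint (map f xs) (map g ys)
map-disjoint xs ys f≢g (p , q) with ∈-map⁻ _ p | ∈-map⁻ _ q
... | _ , _ , e | _ , _ , e′ = f≢g (trans (sym e) e′)

walksStale-unique : ∀ y h → Unique (walksStale y h)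
walksFresh-unique : ∀ y h → Unique (walksFresh y h)
afterOpen-unique : ∀ y h → Unique (afterOpen y h)
afterSecond-unique : ∀ y h → Unique (afterSecond y h)
walksStale-unique zero    zero    = [] ∷ []
walksStale-unique zero    (suc h) = []
walksStale-unique (suc y) h = Unique.++⁺
  (Unique.map⁺ (λ { refl → refl }) (walksFresh-unique y h))
  (Unique.map⁺ (λ { refl → refl }) (walksStale-unique y (suc h)))
  (map-disjoint (walksFresh y h) (walksStale y (suc h)) (λ ()))
walksFresh-unique y h = Unique.++⁺
  (Unique.map⁺ (λ { refl → refl }) (walksStale-unique y h))
  (Unique.++⁺ (afterOpen-unique y h) (afterSecond-unique y h) (open≢second y h))
  stale≢fresh
  where
  open≢second : ∀ y h → Disjoint (afterOpen y h) (afterSecond y h)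
  open≢second y       zero    (() , _)
  open≢second zero    (suc h) (_ , ())
  open≢second (suc y) (suc h) = map-disjoint (walksFresh (suc y) h) (walksFresh y (2 + h)) (λ ())
  stale≢open : ∀ y h → Disjoint (map openStale (walksStale y h)) (afterOpen y h)
  stale≢open y zero    (_ , ())
  stale≢open y (suc h) = map-disjoint (walksStale y (suc h)) (walksFresh y h) (λ ())
  stale≢second : ∀ y h → Disjoint (map openStale (walksStale y h)) (afterSecond y h)
  stale≢second zero    h (_ , ())
  stale≢second (suc y) h = map-disjoint (walksStale (suc y) h) (walksFresh y (suc h)) (λ ())
  stale≢fresh : Disjoint (map openStale (walksStale y h)) (afterOpen y h ++ afterSecond y h)
  stale≢fresh (p , q) with ∈-++⁻ (afterOpen y h) q
  ... | inj₁ r = stale≢open y h (p , r)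
  ... | inj₂ r = stale≢second y h (p , r)
afterOpen-unique y zero    = []
afterOpen-unique y (suc h) = Unique.map⁺ (λ { refl → refl }) (walksFresh-unique y h)
afterSecond-unique zero    h = []
afterSecond-unique (suc y) h = Unique.map⁺ (λ { refl → refl }) (walksFresh-unique y (suc h))

-- Opening is a step east; from a fresh history one more step east ages its top edge, so
-- that a further step north closes that edge.  Each other open edge has width 2.
length-walksStale : ∀ y h → length (walksStale (suc y) h) ≡ ballot y (2 + h * 2)
length-walksFresh : ∀ y h → length (walksFresh y h) ≡ ballot y (1 + h * 2)

length-walksStale y h = begin
  length (map topFresh (walksFresh y h) ++ map topStale (walksStale y (suc h)))
    ≡⟨ length-++ (map topFresh (walksFresh y h)) ⟩
  length (map topFresh (walksFresh y h)) + length (map topStale (walksStale y (suc h)))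
    ≡⟨ cong₂ _+_ (length-map _ (walksFresh y h)) (length-map _ (walksStale y (suc h))) ⟩
  length (walksFresh y h) + length (walksStale y (suc h))
    ≡⟨ cong (_+ length (walksStale y (suc h))) (length-walksFresh y h) ⟩
  ballot y (1 + h * 2) + length (walksStale y (suc h))
    ≡⟨ pop y ⟩
  ballot y (2 + h * 2) ∎
  where
  open ≡-Reasoning
  -- A stale history other than `start` ends in a closing, so it counts paths whose last step is
  -- north; hence `y` in place of `suc y`. `pop` sorts these paths by the step before that one.
  pop : ∀ y → ballot y (1 + h * 2) + length (walksStale y (suc h)) ≡ ballot y (2 + h * 2)
  pop zero    = refl
  pop (suc y) = cong (ballot (suc y) (1 + h * 2) +_) (length-walksStale y (suc h))

length-walksFresh y h = begin
  length (map openStale (walksStale y h) ++ (afterOpen y h ++ afterSecond y h))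
    ≡⟨ length-++ (map openStale (walksStale y h)) ⟩
  length (map openStale (walksStale y h)) + length (afterOpen y h ++ afterSecond y h)
    ≡⟨ cong₂ _+_ (length-map _ (walksStale y h)) (length-++ (afterOpen y h)) ⟩
  length (walksStale y h) + (length (afterOpen y h) + length (afterSecond y h))
    ≡⟨ cases y h ⟩
  ballot y (1 + h * 2) ∎
  where
  open ≡-Reasoning
  after-open : ∀ y h → length (afterOpen y (suc h)) ≡ ballot y (1 + h * 2)
  after-open y h = trans (length-map _ (walksFresh y h)) (length-walksFresh y h)
  after-second : ∀ y h → length (afterSecond (suc y) h) ≡ ballot y (3 + h * 2)
  after-second y h = trans (length-map _ (walksFresh y (suc h))) (length-walksFresh y (suc h))
  cases : ∀ y h → length (walksStale y h) + (length (afterOpen y h) + length (afterSecond y h)) ≡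
          ballot y (1 + h * 2)
  cases zero    zero    = refl
  cases zero    (suc h) = trans (+-identityʳ _) (after-open zero h)
  cases (suc y) zero    = cong₂ _+_ (length-walksStale y zero) (after-second y zero)
  -- `ballot` is unfolded twice, because opening on a fresh state takes two steps east, ageing the
  -- old top and then opening (`c`). The point in between is also reached by a closing, which
  -- contributes `b`.
  cases (suc y) (suc h) = begin
    length (walksStale (suc y) (suc h)) +
      (length (afterOpen (suc y) (suc h)) + length (afterSecond (suc y) (suc h)))
      ≡⟨ cong₂ _+_ (length-walksStale y (suc h))
          (cong₂ _+_ (after-open (suc y) h) (after-second y (suc h))) ⟩
    b + (c + d) ≡⟨ +-assoc b c d ⟨
    b + c + d   ≡⟨ cong (_+ d) (+-comm b c) ⟩
    c + b + d   ∎
    where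
    b = ballot y (4 + h * 2)
    c = ballot (suc y) (1 + h * 2)
    d = ballot y (5 + h * 2)

length-walks : ∀ n → length (walks stale n 0) ≡ ballot n 0
length-walks zero    = refl
length-walks (suc n) = length-walksStale n 0

-- Partial matchings and the closing of an edge

link : ℕ → ℕ → (ℕ → ℕ) → ℕ → ℕ
link a t p i with i ≟ a | i ≟ t
... | yes _ | _     = t
... | no _  | yes _ = a
... | no _  | no _  = p i

data LinkView (a t : ℕ) (p : ℕ → ℕ) (i x : ℕ) : Set where
  isOpener : i ≡ a → x ≡ t → LinkView a t p i x
  isCloser : i ≡ t → x ≡ a → LinkView a t p i x
  isOther  : i ≢ a → i ≢ t → x ≡ p i → LinkView a t p i x

linkView : ∀ a t p i → LinkView a t p i (link a t p i)
linkView a t p i with i ≟ a | i ≟ t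
... | yes i≡a | _       = isOpener i≡a refl
... | no i≢a  | yes i≡t = isCloser i≡t refl
... | no i≢a  | no i≢t  = isOther i≢a i≢t refl

link-opener : ∀ a t p → link a t p a ≡ t
link-opener a t p with linkView a t p a
... | isOpener _ e    = e
... | isCloser a≡t e  = trans e a≡t
... | isOther a≢a _ _ = contradiction refl a≢a

link-closer : ∀ a t p → link a t p t ≡ a
link-closer a t p with linkView a t p t
... | isOpener t≡a e  = trans e t≡a
... | isCloser _ e    = e
... | isOther _ t≢t _ = contradiction refl t≢t

link-other : ∀ {a t i} p → i ≢ a → i ≢ t → link a t p i ≡ p i
link-other {a} {t} {i} p i≢a i≢t with linkView a t p i
... | isOpener i≡a _ = contradiction i≡a i≢a
... | isCloser i≡t _ = contradiction i≡t i≢t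
... | isOther _ _ e  = e

-- A partner function in which the positions below t have been read;
-- the open ones are fixed points.
record Partial (t : ℕ) (p : ℕ → ℕ) : Set where
  field
    invol  : ∀ i → p (p i) ≡ i
    unread : ∀ {i} → t ≤ i → p i ≡ i
    -- An open `b` counts as crossing the edge of `a`, since it can only close later. The conclusion
    -- excludes an open `c` as well, which is already known to be an opener.
    avoid  : ∀ {a b c} → a < b → b < c → c < p a → p b ≡ b ⊎ p a < p b → p c < c

  matched<t : ∀ {i} → p i ≢ i → i < t
  matched<t {i} p≢ with i <? t
  ... | yes i<t = i<t
  ... | no i≮t  = contradiction (unread (≮⇒≥ i≮t)) p≢

  partner<t : ∀ {i} → i < t → p i < t
  partner<t {i} i<t with p i <? t
  ... | yes q = q
  ... | no q  = contradiction (subst (_< t) (trans (sym (invol i)) (unread (≮⇒≥ q))) i<t) q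

IsOpen : ℕ → (ℕ → ℕ) → ℕ → Set
IsOpen t p i = i < t × p i ≡ i

module _ {t : ℕ} {p : ℕ → ℕ} (P : Partial t p) where
  open Partial P

  partial-open : Partial (suc t) p
  partial-open = record { invol = invol ; unread = unread ∘ <⇒≤ ; avoid = avoid }

  module _ {a : ℕ} (a-open : IsOpen t p a) where
    private
      a<t = proj₁ a-open
      pa≡a = proj₂ a-open
      q = link a t p

    -- Closing `a` at `t` creates crossings only with the edges open above `a`; `ok` says that no
    -- opener, closed or still open, follows any of these.
    module _ (ok : ∀ {b c} → a < b → b < c → c < t → p b ≡ b → p c < c) where

      link-avoid : ∀ {x b c} → x < b → b < c → c < q x → q b ≡ b ⊎ q x < q b → q c < c
      link-avoid {x} {b} {c} x<b b<c c<qx h with linkView a t p x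
      ... | isCloser refl e =
          contradiction (<-trans (<-trans x<b b<c) (subst (c <_) e c<qx)) (<-asym a<t)
      ... | isOpener refl e = subst (_< c) (sym qc≡pc) (ok x<b b<c c<t pb≡b)
        where
        c<t = subst (c <_) e c<qx
        b<t = <-trans b<c c<t
        qc≡pc = link-other p (>⇒≢ (<-trans x<b b<c)) (<⇒≢ c<t)
        qb≡pb : q b ≡ p b
        qb≡pb = link-other p (>⇒≢ x<b) (<⇒≢ b<t)
        pb≡b : p b ≡ b
        pb≡b = [ trans (sym qb≡pb)
               , (λ qx<qb → contradiction (subst₂ _<_ e qb≡pb qx<qb) (<-asym (partner<t b<t))) ]′ h
      ... | isOther x≢a x≢t e = subst (_< c) (sym qc≡pc) pc<c
        where
        c<px = subst (c <_) e c<qx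
        x<t : x < t
        x<t = matched<t (>⇒≢ (<-trans (<-trans x<b b<c) c<px))
        c<t = <-trans c<px (partner<t x<t)
        b<t = <-trans b<c c<t
        h′ : p b ≡ b ⊎ p x < p b
        h′ with linkView a t p b
        -- The link turns the open `a` into an edge that crosses the one of `x`; the open
        -- alternative in `avoid` has covered this case in advance.
        ... | isOpener refl _ = inj₁ pa≡a
        ... | isCloser refl _ = contradiction b<t (<-irrefl refl)
        ... | isOther _ _ e′  = Sum.map (trans (sym e′)) (subst₂ _<_ e e′) h
        pc<c = avoid x<b b<c c<px h′
        qc≡pc = link-other p (λ { refl → <-irrefl pa≡a pc<c }) (<⇒≢ c<t)

      partial-close : Partial (suc t) q
      partial-close = record { invol = invol′ ; unread = unread′ ; avoid = link-avoid }
        where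
        invol′ : ∀ i → q (q i) ≡ i
        invol′ i with linkView a t p i
        ... | isOpener refl e = trans (cong q e) (link-closer a t p)
        ... | isCloser refl e = trans (cong q e) (link-opener a t p)
        ... | isOther i≢a i≢t e = trans (cong q e) (trans (link-other p pi≢a pi≢t) (invol i))
          where
          pi≢a : p i ≢ a
          pi≢a pi≡a = i≢a (trans (sym (invol i)) (trans (cong p pi≡a) pa≡a))
          pi≢t : p i ≢ t
          pi≢t pi≡t = i≢t (trans (sym (invol i)) (trans (cong p pi≡t) (unread ≤-refl)))
        unread′ : ∀ {i} → suc t ≤ i → q i ≡ i
        unread′ t<i = trans (link-other p (>⇒≢ (<-trans a<t t<i)) (>⇒≢ t<i)) (unread (<⇒≤ t<i))

    isOpen-unlink : ∀ {i} → IsOpen (suc t) q i → IsOpen t p i × i ≢ a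
    isOpen-unlink {i} (i<1+t , qi≡i) with linkView a t p i
    ... | isOpener refl e   = contradiction (trans (sym qi≡i) e) (<⇒≢ a<t)
    ... | isCloser refl e   = contradiction (trans (sym e) qi≡i) (<⇒≢ a<t)
    ... | isOther i≢a i≢t e = (≤∧≢⇒< (s≤s⁻¹ i<1+t) i≢t , trans (sym e) qi≡i) , i≢a

    isOpen-link : ∀ {i} → IsOpen t p i → i ≢ a → IsOpen (suc t) q i
    isOpen-link (i<t , pi≡i) i≢a = m<n⇒m<1+n i<t , trans (link-other p i≢a (<⇒≢ i<t)) pi≡i

-- The stack of open edges

record Stack {s} (t : ℕ) (p : ℕ → ℕ) (st : Vec ℕ s) : Set where
  field
    sound    : All (IsOpen t p) st
    complete : ∀ {i} → IsOpen t p i → i ∈ᵛ st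
    sorted   : AllPairs _>_ st
open Stack

module _ {t : ℕ} {p : ℕ → ℕ} (P : Partial t p) where
  open Partial P

  stack-push : ∀ {s} {st : Vec ℕ s} → Stack t p st → Stack (suc t) p (t ∷ st)
  stack-push S = record
    { sound    = (≤-refl , unread ≤-refl) ∷ All.map (λ { (i<t , e) → m<n⇒m<1+n i<t , e }) (sound S)
    ; complete = complete′
    ; sorted   = All.map proj₁ (sound S) ∷ sorted S
    }
    where
    complete′ : ∀ {i} → IsOpen (suc t) p i → i ∈ᵛ (t ∷ _)
    complete′ {i} (i<1+t , e) with i ≟ t
    ... | yes i≡t = here i≡t
    ... | no i≢t  = there (complete S (≤∧≢⇒< (s≤s⁻¹ i<1+t) i≢t , e))

  stack-pop : ∀ {s b} {st : Vec ℕ s} → Stack t p (b ∷ st) → Stack (suc t) (link b t p) st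
  stack-pop {b = b} {st} S with sound S | sorted S
  ... | b-open ∷ st-open | b>st ∷ st-sorted = record
    { sound    = All.map (λ { (o , b>i) → isOpen-link P b-open o (<⇒≢ b>i) })
        (All.zip (st-open , b>st))
    ; complete = complete′
    ; sorted   = st-sorted
    }
    where
    complete′ : ∀ {i} → IsOpen (suc t) (link b t p) i → i ∈ᵛ st
    complete′ o with isOpen-unlink P b-open o
    ... | o′ , i≢b with complete S o′
    ...   | here i≡b = contradiction i≡b i≢b
    ...   | there i∈ = i∈

  stack-second : ∀ {s b a} {st : Vec ℕ s} → Stack t p (b ∷ a ∷ st) →
      Stack (suc t) (link a t p) (b ∷ st)
  stack-second {b = b} {a} {st} S with sound S | sorted S
  ... | b-open ∷ a-open ∷ st-open | (b>a ∷ b>st) ∷ (a>st ∷ st-sorted) = record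
    { sound    = isOpen-link P a-open b-open (>⇒≢ b>a) ∷
                 All.map (λ { (o , a>i) → isOpen-link P a-open o (<⇒≢ a>i) })
                     (All.zip (st-open , a>st))
    ; complete = complete′
    ; sorted   = b>st ∷ st-sorted
    }
    where
    complete′ : ∀ {i} → IsOpen (suc t) (link a t p) i → i ∈ᵛ (b ∷ st)
    complete′ o with isOpen-unlink P a-open o
    ... | o′ , i≢a with complete S o′
    ...   | here i≡b         = here i≡b
    ...   | there (here i≡a) = contradiction i≡a i≢a
    ...   | there (there i∈) = there i∈

-- Complete matchings that extend a partial one

-- u agrees with p below t, except that the edges open in p get closed in u at t or later.
Extends : ℕ → (ℕ → ℕ) → (ℕ → ℕ) → Set
Extends t p u = ∀ {i} → i < t → (p i ≢ i → u i ≡ p i) × (p i ≡ i → t ≤ u i)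

module _ {t : ℕ} {p u : ℕ → ℕ} (P : Partial t p) where
  open Partial P

  -- Run backwards, a move reveals what `u` does at `t`, so the final state of a history dictates
  -- every choice made on the way. Injectivity rests on this.
  extends-unopen : Extends (suc t) p u → Extends t p u × t < u t
  extends-unopen E =
    (λ i<t → let f , g = E (m<n⇒m<1+n i<t) in f , <⇒≤ ∘ g) ,
    proj₂ (E ≤-refl) (unread ≤-refl)

  extends-unlink : ∀ {a} → IsOpen t p a → Extends (suc t) (link a t p) u → Extends t p u × u t ≡ a
  extends-unlink {a} (a<t , pa≡a) E = E′ , ut≡a
    where
    ut≡a : u t ≡ a
    ut≡a = trans (proj₁ (E ≤-refl) (λ e → <⇒≢ a<t (trans (sym (link-closer a t p)) e)))
        (link-closer a t p)
    E′ : Extends t p u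
    E′ {i} i<t with linkView a t p i | E (m<n⇒m<1+n i<t)
    ... | isOpener refl e   | f , _ =
      contradiction pa≡a , λ _ → ≤-reflexive (sym (trans (f (λ e′ → <⇒≢ i<t (trans (sym e′) e))) e))
    ... | isCloser refl _   | _     = contradiction i<t (<-irrefl refl)
    ... | isOther i≢a i≢t e | f , g =
        subst (λ x → (x ≢ i → u i ≡ x) × (x ≡ i → t ≤ u i)) e (f , <⇒≤ ∘ g)

  module _ (u-invol : ∀ i → u (u i) ≡ i) (E : Extends t p u) where

    extends-open : t < u t → Extends (suc t) p u
    extends-open t<ut {i} i<1+t with i ≟ t
    ... | yes refl = contradiction (unread ≤-refl) , λ _ → t<ut
    ... | no i≢t   = proj₁ (E i<t) , λ e → ≤∧≢⇒< (proj₂ (E i<t) e) t≢ui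
      where
      i<t = ≤∧≢⇒< (s≤s⁻¹ i<1+t) i≢t
      t≢ui : t ≢ u i
      t≢ui t≡ui = <-asym i<t (subst (t <_) (trans (cong u t≡ui) (u-invol i)) t<ut)

    -- Had `u t` been matched before, its partner would be `t` by involutivity, but partners of read
    -- positions lie below `t`.
    extends-isOpen : u t < t → IsOpen t p (u t)
    extends-isOpen ut<t with p (u t) ≟ u t
    ... | yes e = ut<t , e
    ... | no ¬e = contradiction (subst (_< t) (sym t≡) (partner<t ut<t)) (<-irrefl refl)
      where
      t≡ : t ≡ p (u t)
      t≡ = trans (sym (u-invol t)) (proj₁ (E ut<t) ¬e)

    extends-link : u t < t → Extends (suc t) (link (u t) t p) u
    extends-link ut<t {i} i<1+t with linkView (u t) t p i
    ... | isOpener refl e =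
        (λ _ → trans (u-invol t) (sym e)) , λ e′ → contradiction (trans (sym e′) e) (<⇒≢ ut<t)
    ... | isCloser refl e = (λ _ → sym e) , λ e′ → contradiction (trans (sym e) e′) (<⇒≢ ut<t)
    ... | isOther i≢ut i≢t e =
      subst (λ x → (x ≢ i → u i ≡ x) × (x ≡ i → suc t ≤ u i)) (sym e)
        (proj₁ (E i<t) , λ e′ → ≤∧≢⇒< (proj₂ (E i<t) e′) t≢ui)
      where
      i<t = ≤∧≢⇒< (s≤s⁻¹ i<1+t) i≢t
      t≢ui : t ≢ u i
      t≢ui t≡ui = i≢ut (trans (sym (u-invol i)) (cong u (sym t≡ui)))

-- From histories to avoiding matchings

size : Kind → ℕ → ℕ
size stale h = h
size fresh h = suc h

-- Its value is `y + y + size k h`, but the recursion makes each move a definitional `suc`, which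
-- spares the invariants any transport.
time  : ∀ {k y h} → Walk k y h → ℕ
time start         = 0
time (topFresh w)  = suc (time w)
time (topStale w)  = suc (time w)
time (openStale w) = suc (time w)
time (openFresh w) = suc (time w)
time (second w)    = suc (time w)

stack : ∀ {k y h} → Walk k y h → Vec ℕ (size k h)
stack start         = []
stack (topFresh w)  = tail (stack w)
stack (topStale w)  = tail (stack w)
stack (openStale w) = time w ∷ stack w
stack (openFresh w) = time w ∷ stack w
stack (second w)    = head (stack w) ∷ tail (tail (stack w))

perm : ∀ {k y h} → Walk k y h → ℕ → ℕ
perm start         i = i
perm (topFresh w)  = link (head (stack w)) (time w) (perm w)
perm (topStale w)  = link (head (stack w)) (time w) (perm w)
perm (openStale w) = perm w
perm (openFresh w) = perm w
perm (second w)    = link (head (tail (stack w))) (time w) (perm w)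

time-stale : ∀ {y h} (w : Walk stale y h) → time w ≡ y + y + h
time-fresh : ∀ {y h} (w : Walk fresh y h) → time w ≡ suc (y + y + h)
time-stale start        = refl
time-stale {suc y} {h} (topFresh w) =
    cong suc (trans (time-fresh w) (cong (_+ h) (sym (+-suc y y))))
time-stale {suc y} {h} (topStale w) =
  cong suc (trans (time-stale w) (trans (+-suc (y + y) h) (cong (_+ h) (sym (+-suc y y)))))
time-fresh (openStale w) = cong suc (time-stale w)
time-fresh {y} {suc h} (openFresh w) = cong suc (trans (time-fresh w) (sym (+-suc (y + y) h)))
time-fresh {suc y} {h} (second w)    =
  cong suc (trans (time-fresh w)
      (cong suc (trans (+-suc (y + y) h) (cong (_+ h) (sym (+-suc y y))))))

time-closed : ∀ {y} (w : Walk stale y 0) → time w ≡ 2 * y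
time-closed {y} w = begin
  time w      ≡⟨ time-stale w ⟩
  y + y + 0   ≡⟨ +-assoc y y 0 ⟩
  2 * y       ∎
  where open ≡-Reasoning

-- In a stale history every open edge has a later opener that is already closed: this is
-- what forbids closing the second edge from the top.
Recency : ∀ k h → ℕ → (ℕ → ℕ) → Vec ℕ (size k h) → Set
Recency stale h t p st       = All (λ b → ∃ λ c → b < c × c < p c) st
Recency fresh h t p (b ∷ st) = ∀ {c} → b < c → c < t → p c < c

record Inv k h t p (st : Vec ℕ (size k h)) : Set where
  constructor mkInv
  field
    partialOf : Partial t p
    stackOf   : Stack t p st
    recency   : Recency k h t p st
open Inv
open Stack

below-head : ∀ {s t p b i} {st : Vec ℕ s} → Stack t p (b ∷ st) → i ∈ᵛ st → i < b
below-head S i∈ with sorted S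
... | b>st ∷ _ = All.lookup b>st i∈

above-head : ∀ {s t p b i} {st : Vec ℕ s} → Stack t p (b ∷ st) → IsOpen t p i → i ≤ b
above-head S o with complete S o
... | here i≡b = ≤-reflexive i≡b
... | there i∈ = <⇒≤ (below-head S i∈)

inv-open : ∀ {k h t p st} → Inv k h t p st → Inv fresh (size k h) (suc t) p (t ∷ st)
inv-open (mkInv P S _) = mkInv (partial-open P) (stack-push P S)
  (λ t<c c<1+t → contradiction (s≤s⁻¹ c<1+t) (<⇒≱ t<c))

inv-topFresh : ∀ {h t p b} {st : Vec ℕ h} → Inv fresh h t p (b ∷ st) →
    Inv stale h (suc t) (link b t p) st
inv-topFresh {t = t} {p} {b} (mkInv P S r) with sound S | sorted S
... | b-open ∷ _ | b>st ∷ _ = mkInv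
  (partial-close P b-open (λ b<x x<c c<t _ → r (<-trans b<x x<c) c<t))
  (stack-pop P S)
  -- The edge just closed is itself the later, closed opener for every edge below it.
  (All.map (λ b>i → b , b>i , subst (b <_) (sym (link-opener b t p)) (proj₁ b-open)) b>st)

-- With nothing open above the top, no crossing arises. The openers that witness `Recency` are
-- matched already, so the new link does not touch them.
inv-topStale : ∀ {h t p b} {st : Vec ℕ h} → Inv stale (suc h) t p (b ∷ st) →
    Inv stale h (suc t) (link b t p) st
inv-topStale {t = t} {p} {b} (mkInv P S (_ ∷ r)) with sound S
... | b-open ∷ _ = mkInv
  (partial-close P b-open (λ b<x x<c c<t px≡x →
      contradiction (above-head S (<-trans x<c c<t , px≡x)) (<⇒≱ b<x)))
  (stack-pop P S)
  (All.map (λ { (c , i<c , c<pc) → c , i<c , subst (c <_) (sym (unlinked c<pc)) c<pc }) r)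
  where
  open Partial P
  unlinked : ∀ {c} → c < p c → link b t p c ≡ p c
  unlinked c<pc = link-other p
    (λ { refl → <⇒≢ c<pc (sym (proj₂ b-open)) })
    (λ { refl → <⇒≢ c<pc (sym (unread ≤-refl)) })

-- The top is the only open edge above `a`, and freshness says that no opener follows it. Since `t`
-- is read as a closer, the top stays fresh.
inv-second : ∀ {h t p b a} {st : Vec ℕ h} →
             Inv fresh (suc h) t p (b ∷ a ∷ st) → Inv fresh h (suc t) (link a t p) (b ∷ st)
inv-second {t = t} {p} {b} {a} (mkInv P S r) with sound S | sorted S
... | _ ∷ a-open ∷ _ | (b>a ∷ _) ∷ (a>st ∷ _) = mkInv
  (partial-close P a-open λ a<x x<c c<t px≡x →
      r (subst (_< _) (isHead a<x (<-trans x<c c<t , px≡x)) x<c) c<t)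
  (stack-second P S)
  recency′
  where
  isHead : ∀ {x} → a < x → IsOpen t p x → x ≡ b
  isHead a<x o with complete S o
  ... | here x≡b           = x≡b
  ... | there (here refl)  = contradiction a<x (<-irrefl refl)
  ... | there (there x∈st) = contradiction a<x (<-asym (All.lookup a>st x∈st))
  recency′ : ∀ {c} → b < c → c < suc t → link a t p c < c
  recency′ {c} b<c c<1+t with linkView a t p c
  ... | isOpener refl _    = contradiction b<c (<-asym b>a)
  ... | isCloser refl e    = subst (_< c) (sym e) (proj₁ a-open)
  ... | isOther c≢a c≢t e  = subst (_< c) (sym e) (r b<c (≤∧≢⇒< (s≤s⁻¹ c<1+t) c≢t))

inv : ∀ {k y h} (w : Walk k y h) → Inv k h (time w) (perm w) (stack w)
inv start = mkInv
  (record { invol = λ _ → refl ; unread = λ _ → refl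
          ; avoid = λ a<b b<c c<a _ → contradiction (<-trans a<b b<c) (<-asym c<a) })
  (record { sound = [] ; complete = λ () ; sorted = [] })
  []
inv (openStale w) = inv-open (inv w)
inv (openFresh w) = inv-open (inv w)
inv (topFresh w) with stack w | inv w
... | _ ∷ _ | I = inv-topFresh I
inv (topStale w) with stack w | inv w
... | _ ∷ _ | I = inv-topStale I
inv (second w) with stack w | inv w
... | _ ∷ _ ∷ _ | I = inv-second I

record Avoiding (m : ℕ) (u : ℕ → ℕ) : Set where
  field
    invol   : ∀ i → u (u i) ≡ i
    bounded : ∀ {i} → i < m → u i < m
    matched : ∀ {i} → i < m → u i ≢ i
    avoid   : ∀ {a b c} → a < b → b < c → c < u a → u a < u b → u c < c

perm-avoiding : ∀ {n} (w : Walk stale n 0) → Avoiding (time w) (perm w)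
perm-avoiding w with stack w | inv w
... | [] | mkInv P S _ = record
  { invol   = invol
  ; bounded = partner<t
  ; matched = λ i<t e → nothing-open (complete S (i<t , e))
  ; avoid   = λ a<b b<c c<ua ua<ub → avoid a<b b<c c<ua (inj₂ ua<ub)
  }
  where
  open Partial P
  nothing-open : ∀ {i} → ¬ i ∈ᵛ []
  nothing-open ()

-- Recovering a history from its matching

data State : Set where
  pack : ∀ k y h → Walk k y h → State

-- Defined without proofs about `x`: the state is left as it is when nothing can be closed, and a
-- stale top is popped whatever `x` is. Thus `encode` accepts any function, and histories with equal
-- matchings can be compared through it.
next : ℕ → ℕ → State → State
next t x (pack k y h w) with t <? x
next t x (pack stale y h w)       | yes _ = pack _ _ _ (openStale w)
next t x (pack fresh y h w)       | yes _ = pack _ _ _ (openFresh w)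
next t x (pack stale y zero w)    | no _  = pack _ _ _ w
next t x (pack stale y (suc h) w) | no _  = pack _ _ _ (topStale w)
next t x (pack fresh y h w)       | no _ with x ≟ head (stack w)
next t x (pack fresh y h w)       | no _ | yes _ = pack _ _ _ (topFresh w)
next t x (pack fresh y zero w)    | no _ | no _  = pack _ _ _ w
next t x (pack fresh y (suc h) w) | no _ | no _  = pack _ _ _ (second w)

encode : (ℕ → ℕ) → ℕ → State
encode u zero    = pack _ _ _ start
encode u (suc t) = next t (u t) (encode u t)

next-openStale : ∀ {t x y h} (w : Walk stale y h) → t < x →
    next t x (pack _ _ _ w) ≡ pack _ _ _ (openStale w)
next-openStale {t} {x} w t<x with t <? x
... | yes _  = refl
... | no t≮x = contradiction t<x t≮x

next-openFresh : ∀ {t x y h} (w : Walk fresh y h) → t < x →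
    next t x (pack _ _ _ w) ≡ pack _ _ _ (openFresh w)
next-openFresh {t} {x} w t<x with t <? x
... | yes _  = refl
... | no t≮x = contradiction t<x t≮x

next-topStale : ∀ {t x y h} (w : Walk stale y (suc h)) → x < t →
    next t x (pack _ _ _ w) ≡ pack _ _ _ (topStale w)
next-topStale {t} {x} w x<t with t <? x
... | yes t<x = contradiction t<x (<-asym x<t)
... | no _    = refl

next-topFresh : ∀ {t x y h} (w : Walk fresh y h) → x < t → x ≡ head (stack w) →
                next t x (pack _ _ _ w) ≡ pack _ _ _ (topFresh w)
next-topFresh {t} {x} w x<t x≡ with t <? x
... | yes t<x = contradiction t<x (<-asym x<t)
... | no _ with x ≟ head (stack w)
...   | yes _ = refl
...   | no x≢ = contradiction x≡ x≢

next-second : ∀ {t x y h} (w : Walk fresh y (suc h)) → x < t → x ≢ head (stack w) →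
              next t x (pack _ _ _ w) ≡ pack _ _ _ (second w)
next-second {t} {x} w x<t x≢ with t <? x
... | yes t<x = contradiction t<x (<-asym x<t)
... | no _ with x ≟ head (stack w)
...   | yes x≡ = contradiction x≡ x≢
...   | no _   = refl

head-open : ∀ {s t p} {st : Vec ℕ (suc s)} → Stack t p st → IsOpen t p (head st)
head-open {st = _ ∷ _} S = All.head (sound S)

second-open : ∀ {s t p} {st : Vec ℕ (2 + s)} → Stack t p st →
              IsOpen t p (head (tail st)) × head (tail st) < head st
second-open {st = _ ∷ _ ∷ _} S with sound S | sorted S
... | _ ∷ a-open ∷ _ | (b>a ∷ _) ∷ _ = a-open , b>a

-- The induction shortens the history while `u` stays fixed, so `u` has to be an arbitrary
-- completion of the state rather than `perm w`.
encode-unique : ∀ {k y h u} (w : Walk k y h) → Extends (time w) (perm w) u →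
    encode u (time w) ≡ pack k y h w
encode-unique start E = refl
encode-unique {u = u} (openStale w) E =
  let E′ , t<ut = extends-unopen (partialOf (inv w)) E
  in trans (cong (next _ (u (time w))) (encode-unique w E′)) (next-openStale w t<ut)
encode-unique {u = u} (openFresh w) E =
  let E′ , t<ut = extends-unopen (partialOf (inv w)) E
  in trans (cong (next _ (u (time w))) (encode-unique w E′)) (next-openFresh w t<ut)
encode-unique {u = u} (topStale w) E =
  let b-open = head-open (stackOf (inv w))
      E′ , ut≡b = extends-unlink (partialOf (inv w)) b-open E
  in trans (cong (next _ (u (time w))) (encode-unique w E′))
       (next-topStale w (subst (_< time w) (sym ut≡b) (proj₁ b-open)))
encode-unique {u = u} (topFresh w) E =
  let b-open = head-open (stackOf (inv w))
      E′ , ut≡b = extends-unlink (partialOf (inv w)) b-open E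
  in trans (cong (next _ (u (time w))) (encode-unique w E′))
       (next-topFresh w (subst (_< time w) (sym ut≡b) (proj₁ b-open)) ut≡b)
encode-unique {u = u} (second w) E =
  let a-open , b>a = second-open (stackOf (inv w))
      E′ , ut≡a = extends-unlink (partialOf (inv w)) a-open E
  in trans (cong (next _ (u (time w))) (encode-unique w E′))
       (next-second w (subst (_< time w) (sym ut≡a) (proj₁ a-open)) (λ ut≡b →
           <⇒≢ b>a (trans (sym ut≡a) ut≡b)))

-- Every avoiding matching has a history

module _ {m : ℕ} {u : ℕ → ℕ} (G : Avoiding m u) where
  open Avoiding G

  module _ {t : ℕ} {p : ℕ → ℕ} (P : Partial t p) (E : Extends t p u) (ut<t : u t < t) where

    open-partner : ∀ {i} → IsOpen t p i → i ≢ u t → t < u i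
    open-partner {i} (i<t , pi≡i) i≢ut = ≤∧≢⇒< (proj₂ (E i<t) pi≡i)
      (λ t≡ui → i≢ut (trans (sym (invol i)) (cong u (sym t≡ui))))

    -- An edge closed from below the top `b` would cross it, and `Recency` supplies an opener `c`
    -- between `b` and `t`.
    closes-top : ∀ {h st} → Inv stale (suc h) t p st → u t ≡ head st
    closes-top {st = b ∷ _} (mkInv _ S ((c , b<c , c<pc) ∷ _))
        with complete S (extends-isOpen P invol E ut<t)
    ... | here ut≡b = ut≡b
    ... | there ut∈ = contradiction uc<c (<-asym c<uc)
      where
      ut<b = below-head S ut∈
      c<t  = Partial.matched<t P (>⇒≢ c<pc)
      c<uc = subst (c <_) (sym (proj₁ (E c<t) (>⇒≢ c<pc))) c<pc
      t<ub = open-partner (head-open S) (>⇒≢ ut<b)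
      uut≡t = invol t
      uc<c : u c < c
      uc<c = avoid ut<b b<c (subst (c <_) (sym uut≡t) c<t) (subst (_< u b) (sym uut≡t) t<ub)

    -- An edge closed from below the second edge `a` would cross `a`, with the opener `b` inside the
    -- crossing.
    closes-top-or-second : ∀ {h st} → Inv fresh (suc h) t p st →
        u t ≡ head st ⊎ u t ≡ head (tail st)
    closes-top-or-second {st = b ∷ a ∷ _} (mkInv _ S _)
        with complete S (extends-isOpen P invol E ut<t)
    ... | here ut≡b         = inj₁ ut≡b
    ... | there (here ut≡a) = inj₂ ut≡a
    ... | there (there ut∈) with sound S | sorted S
    ...   | b-open ∷ a-open ∷ _ | (b>a ∷ _) ∷ (a>st ∷ _) = contradiction ub<b (<-asym b<ub)
      where
      ut<a = All.lookup a>st ut∈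
      b<ub = <-trans (proj₁ b-open) (open-partner b-open (>⇒≢ (<-trans ut<a b>a)))
      uut≡t = invol t
      ub<b : u b < b
      ub<b = avoid ut<a b>a (subst (b <_) (sym uut≡t) (proj₁ b-open))
               (subst (_< u a) (sym uut≡t) (open-partner a-open (>⇒≢ ut<a)))

  Encoded : ℕ → Set
  Encoded t = ∃ λ k → ∃ λ y → ∃ λ h → ∃ λ (w : Walk k y h) → time w ≡ t × Extends t (perm w) u

  advance : ∀ k {y} h (w : Walk k y h) → time w < m → Extends (time w) (perm w) u →
      Encoded (suc (time w))
  advance k h w t<m E with <-cmp (u (time w)) (time w) | partialOf (inv w)
  advance k h w t<m E | tri≈ _ ut≡t _ | _ = contradiction ut≡t (matched t<m)
  advance stale h w t<m E | tri> _ _ t<ut | P =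
    _ , _ , _ , openStale w , refl , extends-open P invol E t<ut
  advance fresh h w t<m E | tri> _ _ t<ut | P =
    _ , _ , _ , openFresh w , refl , extends-open P invol E t<ut
  advance stale zero w t<m E | tri< ut<t _ _ | P
    with stack w | complete (stackOf (inv w)) (extends-isOpen P invol E ut<t)
  ... | [] | ()
  advance stale (suc h) w t<m E | tri< ut<t _ _ | P =
    _ , _ , _ , topStale w , refl ,
    subst (λ a → Extends (suc t) (link a t (perm w)) u) (closes-top P E ut<t (inv w))
        (extends-link P invol E ut<t)
    where t = time w
  advance fresh h w t<m E | tri< ut<t _ _ | P with u (time w) ≟ head (stack w)
  ... | yes ut≡b =
    _ , _ , _ , topFresh w , refl ,
    subst (λ a → Extends (suc t) (link a t (perm w)) u) ut≡b (extends-link P invol E ut<t)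
    where t = time w
  advance fresh zero w t<m E | tri< ut<t _ _ | P | no ut≢b
    with stack w | complete (stackOf (inv w)) (extends-isOpen P invol E ut<t)
  ... | _ ∷ [] | here ut≡b = contradiction ut≡b ut≢b
  advance fresh (suc h) w t<m E | tri< ut<t _ _ | P | no ut≢b
      with closes-top-or-second P E ut<t (inv w)
  ... | inj₁ ut≡b = contradiction ut≡b ut≢b
  ... | inj₂ ut≡a =
    _ , _ , _ , second w , refl ,
    subst (λ a → Extends (suc t) (link a t (perm w)) u) ut≡a (extends-link P invol E ut<t)
    where t = time w

  encoded : ∀ t → t ≤ m → Encoded t
  encoded zero    _   = stale , 0 , 0 , start , refl , λ ()
  encoded (suc t) t<m with encoded t (<⇒≤ t<m)
  ... | k , y , h , w , refl , E = advance k h w t<m E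

-- At time `2 * n` all partners are bounded by `2 * n`, so nothing is open. This leaves a stale
-- history with `h = 0`, and its length then forces `y` to be `n`.
full-walk : ∀ {n u} → Avoiding (2 * n) u → ∃ λ (w : Walk stale n 0) → ∀ {i} → i < 2 * n →
    u i ≡ perm w i
full-walk {n} {u} G with encoded G (2 * n) ≤-refl
... | k , y , h , w , tw , E = finish k h w tw (λ {i} → E {i})
  where
  open Avoiding G
  none-open : ∀ {p i} → Extends (2 * n) p u → ¬ IsOpen (2 * n) p i
  none-open E (i<m , e) = contradiction (proj₂ (E i<m) e) (<⇒≱ (bounded i<m))
  head-absent : ∀ {k y h s} (w : Walk k y h) {st : Vec ℕ (suc s)} → time w ≡ 2 * n →
                Extends (2 * n) (perm w) u → ¬ Stack (time w) (perm w) st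
  head-absent w tw E S = none-open E (subst (λ t → IsOpen t (perm w) _) tw (head-open S))
  finish : ∀ k {y} h (w : Walk k y h) → time w ≡ 2 * n → Extends (2 * n) (perm w) u →
           ∃ λ (w : Walk stale n 0) → ∀ {i} → i < 2 * n → u i ≡ perm w i
  finish fresh h w tw E = contradiction (stackOf (inv w)) (head-absent w tw E)
  finish stale (suc h) w tw E = contradiction (stackOf (inv w)) (head-absent w tw E)
  finish stale {y} zero w tw E with *-cancelˡ-≡ y n 2 (trans (sym (time-closed w)) tw)
  ... | refl = w , λ i<m → proj₁ (E i<m) (λ e → none-open E (i<m , e))

perm-injective : ∀ {n} (w w′ : Walk stale n 0) → (∀ {i} → i < 2 * n → perm w i ≡ perm w′ i) → w ≡ w′
perm-injective w w′ w≗w′ = pack-injective (begin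
  pack _ _ _ w              ≡⟨ encode-unique w (extends-closed w λ _ → refl) ⟨
  encode (perm w) (time w)
      ≡⟨ cong (encode (perm w)) (trans (time-closed w) (sym (time-closed w′))) ⟩
  encode (perm w) (time w′)
      ≡⟨ encode-unique w′ (extends-closed w′ λ i<t → w≗w′ (subst (_ <_) (time-closed w′) i<t)) ⟩
  pack _ _ _ w′             ∎)
  where
  open ≡-Reasoning
  pack-injective : ∀ {k y h} {w w′ : Walk k y h} → pack k y h w ≡ pack k y h w′ → w ≡ w′
  pack-injective refl = refl
  extends-closed : ∀ {n u} (w : Walk stale n 0) → (∀ {i} → i < time w → u i ≡ perm w i) →
                   Extends (time w) (perm w) u
  extends-closed w u≗w i<t =
      (λ _ → u≗w i<t) , λ e → contradiction e (Avoiding.matched (perm-avoiding w) i<t)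

-- Labels, openers and occurrences of 12312

module _ {A : Set} {P Q : Pred A 0ℓ} (P? : Decidable P) (Q? : Decidable Q) (P⊆Q : P ⊆ Q) where

  length-filter-mono : ∀ xs → length (filter P? xs) ≤ length (filter Q? xs)
  length-filter-mono [] = z≤n
  length-filter-mono (x ∷ xs) with P? x | Q? x
  ... | yes _  | yes _  = s≤s (length-filter-mono xs)
  ... | yes px | no ¬qx = contradiction (P⊆Q px) ¬qx
  ... | no _   | yes _  = m≤n⇒m≤1+n (length-filter-mono xs)
  ... | no _   | no _   = length-filter-mono xs

  length-filter-strict : ∀ {xs x} → x ∈ xs → ¬ P x → Q x →
      length (filter P? xs) < length (filter Q? xs)
  length-filter-strict {x ∷ xs} (here refl) ¬px qx with P? x | Q? x
  ... | yes px | _      = contradiction px ¬px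
  ... | no _   | yes _  = s≤s (length-filter-mono xs)
  ... | no _   | no ¬qx = contradiction qx ¬qx
  length-filter-strict {y ∷ xs} (there x∈) ¬px qx with P? y | Q? y
  ... | yes _  | yes _  = s≤s (length-filter-strict x∈ ¬px qx)
  ... | yes py | no ¬qy = contradiction (P⊆Q py) ¬qy
  ... | no _   | yes _  = m<n⇒m<1+n (length-filter-strict x∈ ¬px qx)
  ... | no _   | no _   = length-filter-strict x∈ ¬px qx

minF-cases : ∀ {m} (i j : Fin m) → (i Fin.≤ j × minF i j ≡ i) ⊎ (j Fin.< i × minF i j ≡ j)
minF-cases i j with i Fin.≤? j
... | yes i≤j = inj₁ (i≤j , refl)
... | no i≰j  = inj₂ (≰⇒> i≰j , refl)

NoOpenerInCrossing : ∀ {m} → Vec (Fin m) m → Set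
NoOpenerInCrossing v =
    ∀ a b c → a Fin.< b → b Fin.< c → c Fin.< lookup v a → lookup v a Fin.< lookup v b →
                  lookup v c Fin.< c

module _ (n : ℕ) (v : Vec (Fin (2 * n)) (2 * n)) (M : IsMatching n v) where

  private
    π : Fin (2 * n) → Fin (2 * n)
    π = lookup v
    label = canon n v

  opener : Fin (2 * n) → Fin (2 * n)
  opener i = minF i (π i)

  opener-cases : ∀ i → (i Fin.< π i × opener i ≡ i) ⊎ (π i Fin.< i × opener i ≡ π i)
  opener-cases i = Sum.map₁ (λ { (i≤πi , e) → Fin.≤∧≢⇒< i≤πi (proj₂ (M i) ∘ sym) , e })
      (minF-cases i (π i))

  opener-opens : ∀ i → opener i Fin.< π (opener i)
  opener-opens i with opener i | opener-cases i
  ... | _ | inj₁ (i<πi , refl) = i<πi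
  ... | _ | inj₂ (πi<i , refl) = subst (π i Fin.<_) (sym (proj₁ (M i))) πi<i

  opener-≤ : ∀ i → opener i Fin.≤ i
  opener-≤ i with opener i | opener-cases i
  ... | _ | inj₁ (_ , refl)    = ≤-refl
  ... | _ | inj₂ (πi<i , refl) = <⇒≤ πi<i

  opener-partner : ∀ i → opener (π i) ≡ opener i
  opener-partner i with opener-cases i | opener-cases (π i)
  ... | inj₁ (_ , e)    | inj₂ (_ , e′)     = trans e′ (trans (proj₁ (M i)) (sym e))
  ... | inj₂ (_ , e)    | inj₁ (_ , e′)     = trans e′ (sym e)
  ... | inj₁ (i<πi , _) | inj₁ (πi<ππi , _) =
    contradiction (subst (π i Fin.<_) (proj₁ (M i)) πi<ππi) (<-asym i<πi)
  ... | inj₂ (πi<i , _) | inj₂ (ππi<πi , _) =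
    contradiction (subst (Fin._< π i) (proj₁ (M i)) ππi<πi) (<-asym πi<i)

  same-edge : ∀ {i j} → i Fin.< j → opener i ≡ opener j → π i ≡ j × opener i ≡ i
  same-edge {i} {j} i<j e with opener-cases i | opener-cases j
  ... | inj₁ (_ , ei) | inj₁ (_ , ej) =
      contradiction (cong toℕ (trans (sym ei) (trans e ej))) (<⇒≢ i<j)
  ... | inj₁ (_ , ei) | inj₂ (_ , ej) =
    trans (cong π (trans (sym ei) (trans e ej))) (proj₁ (M j)) , ei
  ... | inj₂ (πi<i , ei) | inj₁ (_ , ej) =
    contradiction (subst (Fin._< i) (trans (sym ei) (trans e ej)) πi<i) (<-asym i<j)
  ... | inj₂ (_ , ei) | inj₂ (_ , ej) =
    contradiction (cong toℕ
        (trans (sym (proj₁ (M i))) (trans (cong π (trans (sym ei) (trans e ej))) (proj₁ (M j)))))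
            (<⇒≢ i<j)

  opens-upto? : ∀ i → Decidable (λ j → j Fin.< π j × j Fin.≤ opener i)
  opens-upto? i j = (j Fin.<? π j) ×-dec (j Fin.≤? opener i)

  label-mono-≤ : ∀ i j → opener i Fin.≤ opener j → label i ≤ label j
  label-mono-≤ i j i≤j =
      length-filter-mono (opens-upto? i) (opens-upto? j) (λ { (o , k≤i) → o , ≤-trans k≤i i≤j })
          (List.tabulate id)

  -- The opener of the edge of `j` is counted in `label j` but not in `label i`.
  label-mono-< : ∀ i j → opener i Fin.< opener j → label i < label j
  label-mono-< i j i<j =
      length-filter-strict (opens-upto? i) (opens-upto? j)
      (λ { (o , k≤i) → o , ≤-trans k≤i (<⇒≤ i<j) })
      (∈-tabulate⁺ (opener j)) (λ { (_ , j≤i) → <⇒≱ i<j j≤i }) (opener-opens j , ≤-refl)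

  label-cancel-< : ∀ i j → label i < label j → opener i Fin.< opener j
  label-cancel-< i j i<j = ≰⇒> (λ j≤i → <⇒≱ i<j (label-mono-≤ j i j≤i))

  label-injective : ∀ i j → label i ≡ label j → opener i ≡ opener j
  label-injective i j e with Fin.<-cmp (opener i) (opener j)
  ... | tri< i<j _ _ = contradiction e (<⇒≢ (label-mono-< i j i<j))
  ... | tri≈ _ i≡j _ = i≡j
  ... | tri> _ _ i>j = contradiction e (>⇒≢ (label-mono-< j i i>j))

  label-partner : ∀ i → label (π i) ≡ label i
  label-partner i = ≤-antisym
    (label-mono-≤ (π i) i (Fin.≤-reflexive (opener-partner i)))
    (label-mono-≤ i (π i) (Fin.≤-reflexive (sym (opener-partner i))))

  -- The letter 3 may sit on a closer, so it is moved to the opener of its edge. This lies weakly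
  -- left of `f 2F`, and right of `f 1F` because its label is larger and `f 1F` opens its own edge.
  no-opener-in-crossing⇒avoids : NoOpenerInCrossing v → Avoids n v pattern12312
  no-opener-in-crossing⇒avoids cf (f , f-mono , f-order) =
      contradiction (opener-opens (f 2F)) (<-asym closes)
    where
    same-label : ∀ i j → lookup pattern12312 i ≡ lookup pattern12312 j → label (f i) ≡ label (f j)
    same-label i j e = ≤-antisym
      (≮⇒≥ (λ j<i → <-irrefl (sym e) (Equivalence.from (f-order j i) j<i)))
      (≮⇒≥ (λ i<j → <-irrefl e (Equivalence.from (f-order i j) i<j)))
    edge₁ = same-edge (f-mono 0F 3F (s≤s z≤n))
        (label-injective (f 0F) (f 3F) (same-label 0F 3F refl))
    edge₂ = same-edge (f-mono 1F 4F (s≤s (s≤s z≤n)))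
        (label-injective (f 1F) (f 4F) (same-label 1F 4F refl))
    b<c : f 1F Fin.< opener (f 2F)
    b<c = subst (Fin._< opener (f 2F)) (proj₂ edge₂)
            (label-cancel-< (f 1F) (f 2F) (Equivalence.to (f-order 1F 2F) ≤-refl))
    closes : π (opener (f 2F)) Fin.< opener (f 2F)
    closes = cf (f 0F) (f 1F) (opener (f 2F)) (f-mono 0F 1F (s≤s z≤n)) b<c
      (subst (opener (f 2F) Fin.<_) (sym (proj₁ edge₁))
          (≤-<-trans (opener-≤ (f 2F)) (f-mono 2F 3F ≤-refl)))
      (subst₂ Fin._<_ (sym (proj₁ edge₁)) (sym (proj₁ edge₂)) (f-mono 3F 4F ≤-refl))

  avoids⇒no-opener-in-crossing : Avoids n v pattern12312 → NoOpenerInCrossing v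
  avoids⇒no-opener-in-crossing av a b c a<b b<c c<πa πa<πb with opener-cases c
  ... | inj₂ (πc<c , _) = πc<c
  ... | inj₁ (c<πc , c≡) = contradiction (lookup positions , mono , order) av
    where
    positions = a ∷ b ∷ c ∷ π a ∷ π b ∷ []
    mono : ∀ i j → i Fin.< j → lookup positions i Fin.< lookup positions j
    mono i j = lookup⁺ {R = Fin._<_} Fin.<-trans {xs = positions} (a<b ∷ b<c ∷ c<πa ∷ πa<πb ∷ [-])
    opens : ∀ {i} → i Fin.< π i → opener i ≡ i
    opens {i} i<πi = [ proj₂ ,
        (λ { (πi<i , _) → contradiction πi<i (<-asym i<πi) }) ]′ (opener-cases i)
    opener-mono : ∀ i j → i Fin.< j → i Fin.< π i → j Fin.< π j → label i < label j
    opener-mono i j i<j i<πi j<πj =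
        label-mono-< i j (subst₂ Fin._<_ (sym (opens i<πi)) (sym (opens j<πj)) i<j)
    a<πa = <-trans (<-trans a<b b<c) c<πa
    b<πb = <-trans (<-trans b<c c<πa) πa<πb
    -- Factoring the labels of the five positions through the letters leaves three comparisons
    -- instead of twenty-five. By `bounds`, the last clause is only met at 3.
    labelOf : ℕ → ℕ
    labelOf 1 = label a
    labelOf 2 = label b
    labelOf _ = label c
    labelOf-mono : ∀ {x y} → 1 ≤ x → y ≤ 3 → x < y → labelOf x < labelOf y
    labelOf-mono {1} {2} _ _ _ = opener-mono a b a<b a<πa b<πb
    labelOf-mono {1} {3} _ _ _ = opener-mono a c (<-trans a<b b<c) a<πa c<πc
    labelOf-mono {2} {3} _ _ _ = opener-mono b c b<c b<πb c<πc
    labelOf-mono {1} {1} _ _ (s≤s ())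
    labelOf-mono {2} {2} _ _ (s≤s (s≤s ()))
    labelOf-mono {2} {1} _ _ (s≤s ())
    labelOf-mono {suc (suc (suc x))} _ y≤3 x<y =
        contradiction (≤-trans x<y y≤3) (<⇒≱ (s≤s (s≤s (s≤s (s≤s z≤n)))))
    labelOf-mono {y = suc (suc (suc (suc y)))} _ (s≤s (s≤s (s≤s ()))) _
    bounds : ∀ i → 1 ≤ lookup pattern12312 i × lookup pattern12312 i ≤ 3
    bounds 0F = s≤s z≤n , s≤s z≤n
    bounds 1F = s≤s z≤n , s≤s (s≤s z≤n)
    bounds 2F = s≤s z≤n , ≤-refl
    bounds 3F = s≤s z≤n , s≤s z≤n
    bounds 4F = s≤s z≤n , s≤s (s≤s z≤n)
    labels : ∀ i → label (lookup positions i) ≡ labelOf (lookup pattern12312 i)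
    labels 0F = refl
    labels 1F = refl
    labels 2F = refl
    labels 3F = label-partner a
    labels 4F = label-partner b
    order : ∀ i j → (lookup pattern12312 i < lookup pattern12312 j) ⇔
                    (label (lookup positions i) < label (lookup positions j))
    order i j = mk⇔ forward backward
      where
      increasing : ∀ i j → lookup pattern12312 i < lookup pattern12312 j →
                   label (lookup positions i) < label (lookup positions j)
      increasing i j = subst₂ _<_ (sym (labels i)) (sym (labels j)) ∘ labelOf-mono
          (proj₁ (bounds i)) (proj₂ (bounds j))
      forward = increasing i j
      backward : label (lookup positions i) < label (lookup positions j) →
          lookup pattern12312 i < lookup pattern12312 j
      backward l<l with <-cmp (lookup pattern12312 i) (lookup pattern12312 j)
      ... | tri< x<y _ _ = x<y
      ... | tri≈ _ x≡y _ = contradiction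
          (trans (labels i) (trans (cong labelOf x≡y) (sym (labels j)))) (<⇒≢ l<l)
      ... | tri> _ _ y<x = contradiction l<l (<-asym (increasing j i y<x))

-- Passing between vectors over `Fin` and functions on ℕ

toℕ-view : ∀ {m} i → (∃ λ (j : Fin m) → i ≡ toℕ j) ⊎ m ≤ i
toℕ-view {m} i with i <? m
... | yes i<m = inj₁ (fromℕ< i<m , sym (Fin.toℕ-fromℕ< i<m))
... | no i≮m  = inj₂ (≮⇒≥ i≮m)

-- Fixed points from `m` on make this an involution of all natural numbers when `v` is a matching,
-- in line with unread positions being fixed.
extend : ∀ {m} → Vec (Fin m) m → ℕ → ℕ
extend {m} v i with i <? m
... | yes i<m = toℕ (lookup v (fromℕ< i<m))
... | no _    = i

extend-toℕ : ∀ {m} (v : Vec (Fin m) m) i → extend v (toℕ i) ≡ toℕ (lookup v i)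
extend-toℕ {m} v i with toℕ i <? m
... | yes i<m = cong (toℕ ∘ lookup v) (Fin.fromℕ<-toℕ i i<m)
... | no i≮m  = contradiction (Fin.toℕ<n i) i≮m

extend-≥ : ∀ {m} (v : Vec (Fin m) m) {i} → m ≤ i → extend v i ≡ i
extend-≥ {m} v {i} m≤i with i <? m
... | yes i<m = contradiction m≤i (<⇒≱ i<m)
... | no _    = refl

module _ (n : ℕ) (v : Vec (Fin (2 * n)) (2 * n)) where

  extend-avoiding : IsMatching n v → NoOpenerInCrossing v → Avoiding (2 * n) (extend v)
  extend-avoiding M cf =
      record { invol = invol ; bounded = bounded ; matched = matched ; avoid = avoid }
    where
    u = extend v
    invol : ∀ i → u (u i) ≡ i
    invol i with toℕ-view {2 * n} i
    ... | inj₁ (j , refl) =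
        trans (cong u (extend-toℕ v j)) (trans (extend-toℕ v (lookup v j)) (cong toℕ (proj₁ (M j))))
    ... | inj₂ m≤i        = trans (cong u (extend-≥ v m≤i)) (extend-≥ v m≤i)
    bounded : ∀ {i} → i < 2 * n → u i < 2 * n
    bounded {i} i<m with toℕ-view {2 * n} i
    ... | inj₁ (j , refl) = subst (_< 2 * n) (sym (extend-toℕ v j)) (Fin.toℕ<n (lookup v j))
    ... | inj₂ m≤i        = contradiction m≤i (<⇒≱ i<m)
    matched : ∀ {i} → i < 2 * n → u i ≢ i
    matched {i} i<m with toℕ-view {2 * n} i
    ... | inj₁ (j , refl) = λ e → proj₂ (M j) (Fin.toℕ-injective (trans (sym (extend-toℕ v j)) e))
    ... | inj₂ m≤i        = contradiction m≤i (<⇒≱ i<m)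
    avoid : ∀ {a b c} → a < b → b < c → c < u a → u a < u b → u c < c
    avoid {a} {b} {c} a<b b<c c<ua ua<ub
        with toℕ-view {2 * n} a | toℕ-view {2 * n} b | toℕ-view {2 * n} c
    ... | inj₂ m≤a | _ | _ =
        contradiction (<-trans (<-trans a<b b<c) (subst (c <_) (extend-≥ v m≤a) c<ua))
            (<-irrefl refl)
    ... | inj₁ (a′ , refl) | inj₁ (b′ , refl) | inj₁ (c′ , refl) =
      subst (_< c) (sym (extend-toℕ v c′))
        (cf a′ b′ c′ a<b b<c (subst (c <_) (extend-toℕ v a′) c<ua)
            (subst₂ _<_ (extend-toℕ v a′) (extend-toℕ v b′) ua<ub))
    ... | inj₁ (a′ , refl) | inj₂ m≤b | _ =
        contradiction (≤-trans m≤b (<⇒≤ b<c)) (<⇒≱ (<-trans c<ua (bounded (Fin.toℕ<n a′))))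
    ... | inj₁ (a′ , refl) | _ | inj₂ m≤c =
        contradiction m≤c (<⇒≱ (<-trans c<ua (bounded (Fin.toℕ<n a′))))

  module _ {u : ℕ → ℕ} (G : Avoiding (2 * n) u) (v≗u : ∀ i → toℕ (lookup v i) ≡ u (toℕ i)) where
    open Avoiding G

    avoiding-isMatching : IsMatching n v
    avoiding-isMatching i =
      Fin.toℕ-injective (trans (v≗u (lookup v i)) (trans (cong u (v≗u i)) (invol (toℕ i)))) ,
      λ e → matched (Fin.toℕ<n i) (trans (sym (v≗u i)) (cong toℕ e))

    avoiding-no-opener-in-crossing : NoOpenerInCrossing v
    avoiding-no-opener-in-crossing a b c a<b b<c c<va va<vb = subst (_< toℕ c) (sym (v≗u c))
      (avoid a<b b<c (subst (toℕ c <_) (v≗u a) c<va) (subst₂ _<_ (v≗u a) (v≗u b) va<vb))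

walk-avoiding : ∀ {n} (w : Walk stale n 0) → Avoiding (2 * n) (perm w)
walk-avoiding w = subst (λ m → Avoiding m (perm w)) (time-closed w) (perm-avoiding w)

matching : ∀ n → Walk stale n 0 → Vec (Fin (2 * n)) (2 * n)
matching n w = tabulate λ i → fromℕ< (Avoiding.bounded (walk-avoiding w) (Fin.toℕ<n i))

matching-perm : ∀ n (w : Walk stale n 0) i → toℕ (lookup (matching n w) i) ≡ perm w (toℕ i)
matching-perm n w i = trans (cong toℕ (lookup∘tabulate _ i)) (Fin.toℕ-fromℕ< _)

matching-injective : ∀ {n} {w w′ : Walk stale n 0} → matching n w ≡ matching n w′ → w ≡ w′
matching-injective {n} {w} {w′} e = perm-injective w w′ agree
  where
  agree : ∀ {i} → i < 2 * n → perm w i ≡ perm w′ i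
  agree {i} i<m with toℕ-view {2 * n} i
  ... | inj₁ (j , refl) =
    trans (sym (matching-perm n w j))
        (trans (cong (λ v → toℕ (lookup v j)) e) (matching-perm n w′ j))
  ... | inj₂ m≤i = contradiction m≤i (<⇒≱ i<m)

∈-matchings : ∀ n v →
    v ∈ List.map (matching n) (walks stale n 0) ⇔ (IsMatching n v × Avoids n v pattern12312)
∈-matchings n v = mk⇔ fromWalk toWalk
  where
  fromWalk : v ∈ List.map (matching n) (walks stale n 0) → IsMatching n v × Avoids n v pattern12312
  fromWalk v∈ with ∈-map⁻ (matching n) v∈
  ... | w , _ , refl = M ,
      no-opener-in-crossing⇒avoids n v M
          (avoiding-no-opener-in-crossing n v (walk-avoiding w) (matching-perm n w))
    where M = avoiding-isMatching n v (walk-avoiding w) (matching-perm n w)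
  toWalk : IsMatching n v × Avoids n v pattern12312 → v ∈ List.map (matching n) (walks stale n 0)
  toWalk (M , av) with full-walk (extend-avoiding n v M (avoids⇒no-opener-in-crossing n v M av))
  ... | w , v≗w = subst (_∈ _) (sym v≡) (∈-map⁺ (matching n) (∈-walks w))
    where
    v≡ : v ≡ matching n w
    v≡ = trans (sym (tabulate∘lookup v)) (tabulate-cong λ i → Fin.toℕ-injective
      (trans (sym (extend-toℕ v i)) (trans (v≗w (Fin.toℕ<n i)) (sym (Fin.toℕ-fromℕ< _)))))

theorem2 : (n : ℕ) → 1 ≤ n →
    Σ (List (Vec (Fin (2 * n)) (2 * n))) λ L →
    Unique L ×
    (∀ v → (v ∈ L) ⇔ (IsMatching n v × Avoids n v pattern12312)) ×
    (length L ≡ kCatalan n 3)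
theorem2 n _ =
  map (matching n) (walks stale n 0) ,
  Unique.map⁺ matching-injective (walksStale-unique n 0) ,
  ∈-matchings n ,
  trans (length-map (matching n) (walks stale n 0)) (trans (length-walks n) (ballot≡kCatalan n))
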